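{- Let $D$ be a digraph of order $n$. Then $\lambda(D)=n-1$ if and only if $D$ is a Hessenberg path $(v_1,v_2,\ldots,v_n)$ such that $v_1$ is a source.
   Context: Digraphs are finite, without loops or multiple arcs, though between a pair of vertices there may be an arc in each direction; the order is $n=|V(D)|\ge 1$. $N^-(v)$ is the set of vertices from which there is an arc to $v$. A source is a vertex $v$ with $N^-(v)=\varnothing$. Zero forcing on digraphs: a subset $S\subseteq V(D)$ is colored blue and all other vertices white. Digraph color change rule: if a blue vertex has exactly one white out-neighbor, then that white out-neighbor becomes blue. $S$ is a zero forcing set if repeated application of the rule eventually turns all vertices blue. The zero forcing span $\lambda(D)$ is the number of distinct cardinalities $k$ for which there exist $Z,F\subseteq V(D)$ with $|Z|=|F|=k$ such that $Z$ is a zero forcing set and $F$ is not a zero forcing set. A (directed) path $(v_1,v_2,\ldots,v_k)$ in $D$ (so each $(v_i,v_{i+1})$ is an arc) is Hessenberg if $E(D)$ does not contain any arc of the form $(v_i,v_j)$ with $j>i+1$ (arcs $(v_i,v_j)$ with $j<i$ are allowed). "$D$ is a Hessenberg path $(v_1,\ldots,v_n)$" means that $V(D)=\{v_1,\ldots,v_n\}$ and $(v_1,\ldots,v_n)$ is a Hessenberg path in $D$. -}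

module Defs where

open import Data.Fin using (Fin; toℕ; fromℕ<; _≟_)
open import Data.Fin.Properties using (any?; all?)
open import Data.Fin.Subset using (Subset; _∈_; _∉_; _∪_; _⊃_; ⁅_⁆; ∣_∣; ⊤)
open import Data.Fin.Subset.Induction using (⊃-wellFounded)
open import Data.Fin.Subset.Properties
  using (_∈?_; anySubset?; p⊆p∪q; q⊆p∪q; x∈⁅x⁆)
open import Data.Bool.Properties using () renaming (_≟_ to _≟ᵇ_)
open import Data.List using (length; filter; upTo)
open import Data.Nat using (ℕ; suc; _<_; NonZero; >-nonZero⁻¹)
open import Data.Nat.Properties using () renaming (_≟_ to _≟ⁿ_)
open import Data.Product using (_×_; _,_; ∃; ∃₂; ∃-syntax)
open import Data.Vec.Properties using (≡-dec)
open import Function.Definitions using (Injective; StrictlySurjective)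
open import Induction.WellFounded using (Acc; acc)
open import Level using (0ℓ)
open import Relation.Binary using (Rel; Decidable; Irreflexive)
open import Relation.Binary.Construct.Closure.ReflexiveTransitive
  using (Star; ε; _◅_)
open import Relation.Binary.PropositionalEquality using (_≡_; refl)
open import Relation.Nullary using (¬_; Dec; yes; no; ¬?; _×-dec_; _→-dec_)
import Relation.Unary as U

record Digraph (n : ℕ) : Set₁ where
  infix 4 _⟶_ _⟶?_
  field
    _⟶_      : Rel (Fin n) 0ℓ
    _⟶?_     : Decidable _⟶_
    loopless : Irreflexive _≡_ _⟶_

module _ {n : ℕ} (D : Digraph n) where
  open Digraph D

  Source : Fin n → Set
  Source v = ∀ u → ¬ (u ⟶ v)

  -- With S the set of blue vertices, v is the unique white out-neighbour
  -- of the blue vertex u.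
  Forces : Subset n → Fin n → Fin n → Set
  Forces S u v =
    u ∈ S × v ∉ S × u ⟶ v × (∀ w → u ⟶ w → w ∉ S → w ≡ v)

  ColorChange : Rel (Subset n) 0ℓ
  ColorChange S T = ∃₂ λ u v → Forces S u v × T ≡ S ∪ ⁅ v ⁆

  ZeroForcing : Subset n → Set
  ZeroForcing S = Star ColorChange S ⊤

  -- k is one of the cardinalities counted by the zero forcing span.
  InSpan : ℕ → Set
  InSpan k =
    ∃₂ λ (Z F : Subset n) →
      ∣ Z ∣ ≡ k × ∣ F ∣ ≡ k × ZeroForcing Z × ¬ ZeroForcing F

  forces? : ∀ S u v → Dec (Forces S u v)
  forces? S u v =
    (u ∈? S) ×-dec ¬? (v ∈? S) ×-dec (u ⟶? v) ×-dec
    all? (λ w → (u ⟶? w) →-dec (¬? (w ∈? S) →-dec (w ≟ v)))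

  private
    ∪⁅⁆-⊃ : ∀ {S : Subset n} {v} → v ∉ S → (S ∪ ⁅ v ⁆) ⊃ S
    ∪⁅⁆-⊃ {S} {v} v∉S =
      p⊆p∪q ⁅ v ⁆ , v , q⊆p∪q S ⁅ v ⁆ (x∈⁅x⁆ v) , v∉S

    zeroForcing?′ : ∀ S → Acc _⊃_ S → Dec (ZeroForcing S)
    zeroForcing?′ S (acc rs) with ≡-dec _≟ᵇ_ S ⊤
    ... | yes refl = yes ε
    ... | no S≢⊤ with any? (λ u → any? (λ v → step? u v))
      where
      step? : ∀ u v → Dec (∃[ f ] ZeroForcing (S ∪ ⁅ v ⁆))
      step? u v with forces? S u v
      ... | no ¬f = no λ (f , _) → ¬f f
      ... | yes f@(_ , v∉S , _)
            with zeroForcing?′ (S ∪ ⁅ v ⁆) (rs (∪⁅⁆-⊃ v∉S))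
      ...   | yes z = yes (f , z)
      ...   | no ¬z = no λ (_ , z) → ¬z z
    ... | yes (u , v , f , z) = yes ((u , v , f , refl) ◅ z)
    ... | no ¬step = no λ
      { ε → S≢⊤ refl
      ; ((u , v , f , refl) ◅ z) → ¬step (u , v , f , z) }

  zeroForcing? : U.Decidable ZeroForcing
  zeroForcing? S = zeroForcing?′ S (⊃-wellFounded S)

  inSpan? : U.Decidable InSpan
  inSpan? k = anySubset? λ Z → anySubset? λ F →
    (∣ Z ∣ ≟ⁿ k) ×-dec (∣ F ∣ ≟ⁿ k) ×-dec
    zeroForcing? Z ×-dec ¬? (zeroForcing? F)

  -- Subsets of Fin n have at most n elements, so 0, …, n are the only
  -- cardinalities that can occur.
  zeroForcingSpan : ℕ
  zeroForcingSpan = length (filter inSpan? (upTo (suc n)))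

  record IsPath {k : ℕ} (v : Fin k → Fin n) : Set where
    field
      distinct : Injective _≡_ _≡_ v
      arcs     : ∀ i j → toℕ j ≡ suc (toℕ i) → v i ⟶ v j

  record IsHessenberg {k : ℕ} (v : Fin k → Fin n) : Set where
    field
      isPath    : IsPath v
      noForward : ∀ i j → suc (toℕ i) < toℕ j → ¬ (v i ⟶ v j)

  -- D "is" the Hessenberg path v: the path also visits every vertex.
  IsHessenbergPath : (Fin n → Fin n) → Set
  IsHessenbergPath v = IsHessenberg v × StrictlySurjective _≡_ v

first : ∀ {n} .{{_ : NonZero n}} → Fin n
first {n} = fromℕ< (>-nonZero⁻¹ n)

{-# OPTIONS --safe #-}

-- Only k = 1, …, n − 1 can be counted by the span, so λ(D) = n − 1 says that
-- each of them is counted; what matters are the two extremes.  A failed set of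
-- size n − 1 misses a single vertex, which must be a source.  In a run from a
-- one-vertex set {u} only the latest blue vertex can force, so the forcing
-- order is a Hessenberg path from u, and the source, having no predecessor on
-- it, is u.  Conversely, on a Hessenberg path starting at a source v₁ a set is
-- zero forcing exactly when it contains v₁.
module Submission where

open import Defs
open import Data.Fin using (Fin; zero; suc; toℕ; fromℕ<; inject₁; _≟_)
open import Data.Fin.Properties
  using (all?; ¬∀⟶∃¬-smallest; cantor-schröder-bernstein; toℕ-injective; toℕ-inject;
         toℕ-fromℕ<; toℕ-inject₁)
open import Data.Fin.Subset
  using (Subset; inside; outside; _∈_; _∉_; _⊃_; _∪_; ⁅_⁆; ∁; ∣_∣; ⊤; ⊥)
open import Data.Fin.Subset.Induction using (⊃-wellFounded)
open import Data.Fin.Subset.Properties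
  using (_∈?_; ∈⊤; ⊆⊤; ⊆-antisym; ∣p∣≡n⇒p≡⊤; Empty-unique; ∉⊥; ∣⊥∣≡0;
         x∈⁅x⁆; x∈⁅y⁆⇒x≡y; p⊆p∪q; q⊆p∪q; x∈p∪q⁻; ∣∁p∣≡n∸∣p∣;
         x∈p⇒x∉∁p; x∉p⇒x∈∁p; x∉∁p⇒x∈p)
open import Data.List using (List; []; _∷_; _++_; length; filter; applyUpTo; upTo)
open import Data.List.Properties
  using (filter-all; filter-notAll; filter-reject; filter-++; length-applyUpTo;
         applyUpTo-∷ʳ; ++-identityʳ)
open import Data.List.Relation.Unary.All using (All) renaming (all? to listAll?)
open import Data.List.Relation.Unary.All.Properties
  using (applyUpTo⁺₁; applyUpTo⁻; ¬All⇒Any¬)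
open import Data.Nat using (ℕ; zero; suc; NonZero; _∸_; _≤_; _<_; z<s; s≤s; s<s⁻¹)
open import Data.Nat.Properties
  using (≤-reflexive; <-irrefl; <⇒≤; <-cmp; suc-injective; n<1+n; m∸n≤m; m∸[m∸n]≡n;
         m+n∸n≡m)
open import Data.Product using (Σ; _×_; _,_; ∃; proj₁; proj₂)
open import Data.Sum using (inj₁; inj₂; [_,_]′)
open import Data.Vec using ([]; _∷_; there)
open import Function using (_∘_; id)
open import Function.Bundles using (_⇔_; mk⇔; Equivalence)
open import Induction.WellFounded using (Acc; acc)
open import Relation.Binary using (tri<; tri≈; tri>)
open import Relation.Binary.Construct.Closure.ReflexiveTransitive using (ε; _◅_)
open import Relation.Binary.PropositionalEquality
  using (_≡_; _≢_; refl; sym; trans; cong; subst)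
open import Relation.Nullary using (¬_; yes; no; contradiction)
import Relation.Unary as U

-- Filtered lists, subsets of prescribed size, and bijections

length-filter⇔All : ∀ {a p} {A : Set a} {P : U.Pred A p} (P? : U.Decidable P) xs →
  length (filter P? xs) ≡ length xs ⇔ All P xs
length-filter⇔All P? xs = mk⇔ to (cong length ∘ filter-all P?)
  where
  to : length (filter P? xs) ≡ length xs → All _ xs
  to eq with listAll? P? xs
  ... | yes all = all
  ... | no ¬all =
    contradiction (filter-notAll P? xs (¬All⇒Any¬ P? xs ¬all)) (<-irrefl eq)

subset-of-size : ∀ n k → k ≤ n → ∃ λ (S : Subset n) → ∣ S ∣ ≡ k
subset-of-size zero    zero    _         = [] , refl
subset-of-size (suc n) zero    _         = ⊥ , ∣⊥∣≡0 (suc n)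
subset-of-size (suc n) (suc k) (s≤s k≤n) with subset-of-size n k k≤n
... | S , eq = inside ∷ S , cong suc eq

subset-avoiding : ∀ {n} (x : Fin n) k → k < n → ∃ λ (S : Subset n) → ∣ S ∣ ≡ k × x ∉ S
subset-avoiding {suc n} zero k (s≤s k≤n) with subset-of-size n k k≤n
... | S , eq = outside ∷ S , eq , λ ()
subset-avoiding {suc n} (suc x) zero _ = ⊥ , ∣⊥∣≡0 (suc n) , ∉⊥
subset-avoiding {suc n} (suc x) (suc k) (s≤s k<n) with subset-avoiding x k k<n
... | S , eq , x∉S = inside ∷ S , cong suc eq , λ { (there x∈S) → x∉S x∈S }

-- Obtained as the complement of a set of size `n ∸ k` that avoids `x`; `0 < k` makes that size
-- smaller than `n`.
subset-containing : ∀ {n} (x : Fin n) k → 0 < k → k ≤ n →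
  ∃ λ (S : Subset n) → ∣ S ∣ ≡ k × x ∈ S
subset-containing {n} x k 0<k k≤n with subset-avoiding x (n ∸ k) (n∸k<n 0<k k≤n)
  where
  n∸k<n : ∀ {n k} → 0 < k → k ≤ n → n ∸ k < n
  n∸k<n {suc n} {suc k} _ _ = s≤s (m∸n≤m n k)
... | S , eq , x∉S =
  ∁ S , trans (∣∁p∣≡n∸∣p∣ S) (trans (cong (n ∸_) eq) (m∸[m∸n]≡n k≤n)) , x∉p⇒x∈∁p x∉S

∣S∣≡0⇒x∉S : ∀ {n} {S : Subset n} → ∣ S ∣ ≡ 0 → ∀ {x} → x ∉ S
∣S∣≡0⇒x∉S {S = outside ∷ S} eq (there x∈S) = ∣S∣≡0⇒x∉S eq x∈S

∣S∣≡0⇒S≡⊥ : ∀ {n} (S : Subset n) → ∣ S ∣ ≡ 0 → S ≡ ⊥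
∣S∣≡0⇒S≡⊥ S eq = Empty-unique (∣S∣≡0⇒x∉S eq ∘ proj₂)

∣S∣≡1⇒singleton : ∀ {n} (S : Subset n) → ∣ S ∣ ≡ 1 → ∃ λ x → S ≡ ⁅ x ⁆
∣S∣≡1⇒singleton (inside ∷ S) eq =
  zero , cong (inside ∷_) (∣S∣≡0⇒S≡⊥ S (suc-injective eq))
∣S∣≡1⇒singleton (outside ∷ S) eq with ∣S∣≡1⇒singleton S eq
... | x , refl = suc x , refl

all∈⇒≡⊤ : ∀ {n} {S : Subset n} → (∀ x → x ∈ S) → S ≡ ⊤
all∈⇒≡⊤ all = ⊆-antisym ⊆⊤ (λ {x} _ → all x)

-- A section of `f` is an injection in the other direction. This pins the length of a forcing path
-- through all vertices to the order of the digraph.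
bijective⇒≡ : ∀ {m n} {f : Fin m → Fin n} → (∀ {i j} → f i ≡ f j → i ≡ j) →
  (∀ y → ∃ λ i → f i ≡ y) → m ≡ n
bijective⇒≡ {f = f} inj surj = cantor-schröder-bernstein inj
  λ {x} {y} eq → trans (sym (proj₂ (surj x))) (trans (cong f eq) (proj₂ (surj y)))

-- Extreme cardinalities and sources

module _ {n : ℕ} (D : Digraph n) where
  open Digraph D

  -- Only the empty set has size 0, so `Z` and `F` would coincide.
  ¬InSpan-0 : ¬ InSpan D 0
  ¬InSpan-0 (Z , F , ∣Z∣≡0 , ∣F∣≡0 , zf , ¬zf)
    with ∣S∣≡0⇒S≡⊥ Z ∣Z∣≡0 | ∣S∣≡0⇒S≡⊥ F ∣F∣≡0
  ... | refl | refl = ¬zf zf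

  ¬InSpan-n : ¬ InSpan D n
  ¬InSpan-n (Z , F , _ , ∣F∣≡n , _ , ¬zf) with ∣p∣≡n⇒p≡⊤ {p = F} ∣F∣≡n
  ... | refl = ¬zf ε

  -- A vertex turns blue only along an arc into it, so a white source stays white through every
  -- step.
  source∉⇒¬ZeroForcing : ∀ {s} → Source D s → ∀ {S} → s ∉ S → ¬ ZeroForcing D S
  source∉⇒¬ZeroForcing src s∉S ε = s∉S ∈⊤
  source∉⇒¬ZeroForcing src {S} s∉S ((u , v , (_ , _ , u⟶v , _) , refl) ◅ zf) =
    source∉⇒¬ZeroForcing src s∉S∪v zf
    where
    s∉S∪v : _ ∉ S ∪ ⁅ v ⁆
    s∉S∪v s∈ with x∈p∪q⁻ S ⁅ v ⁆ s∈
    ... | inj₁ s∈S = s∉S s∈S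
    ... | inj₂ s∈v with x∈⁅y⁆⇒x≡y v s∈v
    ...   | refl = src u u⟶v

  -- An in-neighbour of `s` differs from `s` by looplessness, hence is blue with `s` as its only
  -- white out-neighbour; a single force would finish the run.
  cosingleton-failed⇒source : ∀ {F s} → s ∉ F → (∀ x → x ≢ s → x ∈ F) →
    ¬ ZeroForcing D F → Source D s
  cosingleton-failed⇒source {F} {s} s∉F rest ¬zf u u⟶s =
    ¬zf ((u , s , (rest u (λ u≡s → loopless u≡s u⟶s) , s∉F , u⟶s , only-s) , refl)
         ◅ subst (ZeroForcing D) (sym (all∈⇒≡⊤ blue)) ε)
    where
    only-s : ∀ w → u ⟶ w → w ∉ F → w ≡ s
    only-s w _ w∉F with w ≟ s
    ... | yes w≡s = w≡s
    ... | no w≢s = contradiction (rest w w≢s) w∉F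

    blue : ∀ x → x ∈ F ∪ ⁅ s ⁆
    blue x with x ≟ s
    ... | yes refl = q⊆p∪q F ⁅ s ⁆ (x∈⁅x⁆ s)
    ... | no x≢s = p⊆p∪q ⁅ s ⁆ (rest x x≢s)

  -- Forcing order as a Hessenberg path

  singleton-Hessenberg : (v : Fin 1 → Fin n) → IsHessenberg D v
  singleton-Hessenberg v = record
    { isPath    = record
      { distinct = λ { {zero} {zero} _ → refl }
      ; arcs     = λ { zero zero () } }
    ; noForward = λ { zero zero () } }

  -- The white vertices, in forcing order, preceded by the blue vertex u.
  record ForcingPath (S : Subset n) (u : Fin n) : Set where
    field
      {len}      : ℕ
      path       : Fin (suc len) → Fin n
      start      : path zero ≡ u
      hessenberg : IsHessenberg D path
      white      : ∀ i → path (suc i) ∉ S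
      covers     : ∀ x → x ∉ S → ∃ λ i → path i ≡ x

  -- Any blue vertex other than u has no white out-neighbour, so only u can
  -- force; afterwards the same holds with the newly forced vertex as u.
  forcingPath : ∀ {S u} → u ∈ S → (∀ {x} → x ∈ S → x ≢ u → ∀ {w} → x ⟶ w → w ∈ S) →
    ZeroForcing D S → ForcingPath S u
  -- The run is over and `S` is `⊤`: no white vertex is left to follow `u`.
  forcingPath {u = u} u∈S closed ε = record
    { path       = λ _ → u
    ; start      = refl
    ; hessenberg = singleton-Hessenberg _
    ; white      = λ ()
    ; covers     = λ _ x∉⊤ → contradiction ∈⊤ x∉⊤
    }
  forcingPath {S} {u} u∈S closed ((u′ , w , (u′∈S , w∉S , u′⟶w , only-w) , refl) ◅ zf)
    with u′ ≟ u
  ... | no u′≢u = contradiction (closed u′∈S u′≢u u′⟶w) w∉S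
  ... | yes refl = record
    { path       = v
    ; start      = refl
    ; hessenberg = record
        { isPath = record { distinct = distinct′ ; arcs = arcs′ } ; noForward = noForward′ }
    ; white      = v′∉S
    ; covers     = covers′
    }
    where
    w∈ : w ∈ S ∪ ⁅ w ⁆
    w∈ = q⊆p∪q S ⁅ w ⁆ (x∈⁅x⁆ w)

    -- Once `w` is forced, `u` has no white out-neighbour. This preserves the invariant `closed` and
    -- rules out forward arcs from `u`.
    out⊆ : ∀ {y} → u ⟶ y → y ∈ S ∪ ⁅ w ⁆
    out⊆ {y} u⟶y with y ∈? S
    ... | yes y∈S = p⊆p∪q ⁅ w ⁆ y∈S
    ... | no  y∉S with only-w y u⟶y y∉S
    ...   | refl = w∈

    closed′ : ∀ {x} → x ∈ S ∪ ⁅ w ⁆ → x ≢ w → ∀ {y} → x ⟶ y → y ∈ S ∪ ⁅ w ⁆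
    closed′ {x} x∈ x≢w x⟶y with x∈p∪q⁻ S ⁅ w ⁆ x∈ | x ≟ u
    ... | inj₂ x∈w | _        = contradiction (x∈⁅y⁆⇒x≡y w x∈w) x≢w
    ... | inj₁ x∈S | yes refl = out⊆ x⟶y
    ... | inj₁ x∈S | no x≢u   = p⊆p∪q ⁅ w ⁆ (closed x∈S x≢u x⟶y)

    module P = ForcingPath (forcingPath w∈ closed′ zf)
    module H = IsHessenberg P.hessenberg
    module Q = IsPath H.isPath

    v : Fin (suc (suc P.len)) → Fin n
    v zero    = u
    v (suc i) = P.path i

    v′∉S : ∀ i → P.path i ∉ S
    v′∉S zero    p∈S = w∉S (subst (_∈ S) P.start p∈S)
    v′∉S (suc i) p∈S = P.white i (p⊆p∪q ⁅ w ⁆ p∈S)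

    distinct′ : ∀ {i j} → v i ≡ v j → i ≡ j
    distinct′ {zero}  {zero}  _  = refl
    distinct′ {zero}  {suc j} eq = contradiction (subst (_∈ S) eq u∈S) (v′∉S j)
    distinct′ {suc i} {zero}  eq = contradiction (subst (_∈ S) (sym eq) u∈S) (v′∉S i)
    distinct′ {suc i} {suc j} eq = cong suc (Q.distinct eq)

    arcs′ : ∀ i j → toℕ j ≡ suc (toℕ i) → v i ⟶ v j
    arcs′ zero    (suc zero) _  = subst (u ⟶_) (sym P.start) u′⟶w
    arcs′ (suc i) (suc j)    eq = Q.arcs i j (suc-injective eq)

    noForward′ : ∀ i j → suc (toℕ i) < toℕ j → ¬ (v i ⟶ v j)
    -- Entries beyond `w` are still white in `S ∪ ⁅ w ⁆`, where all out-neighbours of `u` are blue.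
    noForward′ zero    (suc (suc j)) _  = P.white j ∘ out⊆
    noForward′ zero    (suc zero) (s≤s ())
    noForward′ (suc i) (suc j)       lt = H.noForward i j (s<s⁻¹ lt)

    covers′ : ∀ x → x ∉ S → ∃ λ i → v i ≡ x
    covers′ x x∉S with x ≟ w
    ... | yes refl = suc zero , P.start
    ... | no x≢w with P.covers x ([ x∉S , x≢w ∘ x∈⁅y⁆⇒x≡y w ]′ ∘ x∈p∪q⁻ S ⁅ w ⁆)
    ...   | i , eq = suc i , eq

  -- The preceding vertex has an arc to it; hence a source on a path can only be its first vertex.
  path-tail-not-source : ∀ {k} {v : Fin (suc k) → Fin n} → IsPath D v →
    ∀ i → ¬ Source D (v (suc i))
  path-tail-not-source {v = v} isPath i src =
    src (v (inject₁ i)) (IsPath.arcs isPath (inject₁ i) (suc i) (cong suc (sym (toℕ-inject₁ i))))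

-- Both directions for order `suc m`

module _ {m : ℕ} (D : Digraph (suc m)) where
  open Digraph D

  -- 0 and suc m are never counted, hence the range 1, …, m.
  span⇔InSpan : zeroForcingSpan D ≡ m ⇔ (∀ {i} → i < m → InSpan D (suc i))
  span⇔InSpan = mk⇔ to from
    where
    inner : List ℕ
    inner = applyUpTo suc m

    lf = length-filter⇔All (inSpan? D) inner

    filter≡ : filter (inSpan? D) (upTo (suc (suc m))) ≡ filter (inSpan? D) inner
    filter≡ = trans (filter-reject (inSpan? D) (¬InSpan-0 D))
      (trans (cong (filter (inSpan? D)) (sym (applyUpTo-∷ʳ suc m)))
      (trans (filter-++ (inSpan? D) inner (suc m ∷ []))
      (trans (cong (filter (inSpan? D) inner ++_)
               (filter-reject (inSpan? D) (¬InSpan-n D)))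
             (++-identityʳ _))))

    to : zeroForcingSpan D ≡ m → ∀ {i} → i < m → InSpan D (suc i)
    to eq = applyUpTo⁻ suc m (Equivalence.to lf
      (trans (cong length (sym filter≡)) (trans eq (sym (length-applyUpTo suc m)))))

    from : (∀ {i} → i < m → InSpan D (suc i)) → zeroForcingSpan D ≡ m
    from counted = trans (cong length filter≡)
      (trans (Equivalence.from lf (applyUpTo⁺₁ suc m counted)) (length-applyUpTo suc m))

  failed-of-size-m⇒source : ∀ F → ∣ F ∣ ≡ m → ¬ ZeroForcing D F → ∃ (Source D)
  failed-of-size-m⇒source F ∣F∣≡m ¬zf
    with ∣S∣≡1⇒singleton (∁ F) (trans (∣∁p∣≡n∸∣p∣ F)
           (trans (cong (suc m ∸_) ∣F∣≡m) (m+n∸n≡m 1 m)))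
  ... | s , ∁F≡s = s , cosingleton-failed⇒source D s∉F rest ¬zf
    where
    s∉F : s ∉ F
    s∉F s∈F = x∈p⇒x∉∁p s∈F (subst (s ∈_) (sym ∁F≡s) (x∈⁅x⁆ s))

    rest : ∀ x → x ≢ s → x ∈ F
    rest x x≢s = x∉∁p⇒x∈p (x≢s ∘ x∈⁅y⁆⇒x≡y s ∘ subst (x ∈_) ∁F≡s)

  forcing-singleton⇒Hessenberg : ∀ u → ZeroForcing D ⁅ u ⁆ → ∃ (Source D) →
    ∃ λ v → IsHessenbergPath D v × Source D (v zero)
  forcing-singleton⇒Hessenberg u zf (s , src) =
    finish (bijective⇒≡ distinct surj) P.path P.hessenberg surj
    where
    -- No vertex other than `u` is blue, so the closure condition is vacuous.
    module P = ForcingPath (forcingPath D (x∈⁅x⁆ u)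
      (λ x∈u x≢u → contradiction (x∈⁅y⁆⇒x≡y u x∈u) x≢u) zf)
    open IsPath (IsHessenberg.isPath P.hessenberg) using (distinct)

    surj : ∀ x → ∃ λ i → P.path i ≡ x
    surj x with x ≟ u
    ... | yes refl = zero , P.start
    ... | no x≢u   = P.covers x (x≢u ∘ x∈⁅y⁆⇒x≡y u)

    -- The length is generalised to a variable `k` so that the equation can be matched with `refl`.
    finish : ∀ {k} → suc k ≡ suc m → (v : Fin (suc k) → Fin (suc m)) → IsHessenberg D v →
      (∀ x → ∃ λ i → v i ≡ x) → ∃ λ v → IsHessenbergPath D v × Source D (v zero)
    finish refl v h surj with surj s
    ... | zero  , refl = v , (h , surj) , src
    ... | suc i , refl = contradiction src (path-tail-not-source D (IsHessenberg.isPath h) i)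

  -- The first white vertex on the path is forced by its predecessor; the recursion ends because the
  -- blue set grows.
  start∈⇒ZeroForcing : ∀ {v} → IsHessenbergPath D v → ∀ {S} → v zero ∈ S → ZeroForcing D S
  start∈⇒ZeroForcing {v} (h , surj) {S} = go S (⊃-wellFounded S)
    where
    open IsHessenberg h
    open IsPath isPath

    go : ∀ S → Acc _⊃_ S → v zero ∈ S → ZeroForcing D S
    go S (acc rs) start∈S with all? (λ i → v i ∈? S)
    ... | yes all = subst (ZeroForcing D) (sym (all∈⇒≡⊤ λ x →
                      subst (_∈ S) (proj₂ (surj x)) (all (proj₁ (surj x))))) ε
    ... | no ¬all with ¬∀⟶∃¬-smallest _ _ (λ i → v i ∈? S) ¬all
    ...   | zero  , vi∉S , _ = contradiction start∈S vi∉S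
    ...   | suc i , w∉S , below = (u , w , (u∈S , w∉S , u⟶w , only-w) , refl)
            ◅ go (S ∪ ⁅ w ⁆)
                 (rs (p⊆p∪q ⁅ w ⁆ , w , q⊆p∪q S ⁅ w ⁆ (x∈⁅x⁆ w) , w∉S))
                 (p⊆p∪q ⁅ w ⁆ start∈S)
      where
      u = v (inject₁ i)
      w = v (suc i)

      below′ : ∀ j → toℕ j < suc (toℕ i) → v j ∈ S
      below′ j j<i = subst (λ j → v j ∈ S)
        (toℕ-injective (trans (toℕ-inject (fromℕ< j<i)) (toℕ-fromℕ< j<i)))
        (below (fromℕ< j<i))

      u∈S : u ∈ S
      u∈S = below′ (inject₁ i) (s≤s (≤-reflexive (toℕ-inject₁ i)))

      u⟶w : u ⟶ w
      u⟶w = arcs (inject₁ i) (suc i) (cong suc (sym (toℕ-inject₁ i)))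

      -- Indices up to `i` are blue by minimality, and an arc from `u` to an index beyond `suc i`
      -- would violate the Hessenberg condition.
      only-w : ∀ x → u ⟶ x → x ∉ S → x ≡ w
      only-w x u⟶x x∉S with surj x
      ... | j , refl with <-cmp (toℕ j) (suc (toℕ i))
      ...   | tri< j<1+i _ _ = contradiction (below′ j j<1+i) x∉S
      ...   | tri≈ _ j≡1+i _ = cong v (toℕ-injective j≡1+i)
      ...   | tri> _ _ 1+i<j = contradiction u⟶x (noForward (inject₁ i) j
                (subst (λ t → suc t < toℕ j) (sym (toℕ-inject₁ i)) 1+i<j))

  Hessenberg⇒InSpan : ∀ {v} → IsHessenbergPath D v → Source D (v zero) →
    ∀ {i} → i < m → InSpan D (suc i)
  Hessenberg⇒InSpan {v} hp src {i} i<m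
    with subset-containing (v zero) (suc i) z<s (s≤s (<⇒≤ i<m))
       | subset-avoiding (v zero) (suc i) (s≤s i<m)
  ... | Z , ∣Z∣ , start∈Z | F , ∣F∣ , start∉F =
    Z , F , ∣Z∣ , ∣F∣ , start∈⇒ZeroForcing hp start∈Z , source∉⇒¬ZeroForcing D src start∉F

InSpan⇒Hessenberg : ∀ {m} (D : Digraph (suc m)) → (∀ {i} → i < m → InSpan D (suc i)) →
  ∃ λ v → IsHessenbergPath D v × Source D (v zero)
-- At order 1 the range of sizes is empty, and the only vertex is a source by looplessness.
InSpan⇒Hessenberg {zero} D _ = id , (singleton-Hessenberg D id , λ x → x , refl) ,
  λ { zero → Digraph.loopless D refl }
-- At order `m + 2` only the sizes 1 and `m + 1` are used: a zero forcing singleton from the first,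
-- a failed set missing one vertex from the second.
InSpan⇒Hessenberg {suc m} D inSpan with inSpan z<s | inSpan (n<1+n m)
... | Z , _ , ∣Z∣≡1 , _ , zf , _ | _ , F , _ , ∣F∣≡1+m , _ , ¬zf
  with ∣S∣≡1⇒singleton Z ∣Z∣≡1
... | u , refl = forcing-singleton⇒Hessenberg D u zf (failed-of-size-m⇒source D F ∣F∣≡1+m ¬zf)

theorem19 : (n : ℕ) .{{_ : NonZero n}} (D : Digraph n) →
    zeroForcingSpan D ≡ n ∸ 1 ⇔
    Σ (Fin n → Fin n) (λ v → IsHessenbergPath D v × Source D (v first))
theorem19 (suc m) D = mk⇔
  (λ eq → InSpan⇒Hessenberg D (Equivalence.to (span⇔InSpan D) eq))
  (λ (_ , hp , src) → Equivalence.from (span⇔InSpan D) (Hessenberg⇒InSpan D hp src))
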